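{- Let $k\ge 1$ and $C\ge 1$ be integers. Consider stateless addressing: objects arrive one after another and, as long as no bin is full, each object is independently assigned to bin $i$ with probability $p_i$, $i=1,\dots,k$, where $(p_1,\dots,p_k)$ is a fixed probability vector. Let $N_1$ be the number of objects assigned before any bin is full. Then, among all probability vectors $(p_1,\dots,p_k)$, both (i) for every number $l$ of objects assigned, the probability that no bin is full after $l$ objects have been assigned, and (ii) the expectation $E[N_1]$ are maximized by the uniform distribution $p_1=\dots=p_k=1/k$, which is the distribution used by RJ-CH.
   Context: A bin is full if it contains $C$ objects. $N_1$ is counted so that, for every integer $l\ge 0$, $N_1>l$ if and only if no bin is full after the first $l$ objects have been assigned (i.e. $N_1$ is the number of objects assigned up to and including the one that makes some bin full for the first time). Stateless addressing means that the assignment probabilities do not depend on the numbers of objects in the non-full bins. RJ-CH (random jump consistent hashing) assigns each object to a bin chosen uniformly at random among the $k$ bins, as long as no bin is full. -}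

module Defs where

open import Algebra.Apartness.Bundles using (HeytingCommutativeRing; HeytingField)
open import Algebra.Bundles using (CommutativeRing)
import Algebra.Apartness.Properties.HeytingCommutativeRing as HeytingProperties
import Algebra.Properties.Ring as RingProperties
import Algebra.Properties.Semiring.Mult as SemiringMult
import Algebra.Properties.Semiring.Sum as SemiringSum
open import Data.Bool.Base using (if_then_else_)
open import Data.Fin.Base using (Fin; zero; suc)
open import Data.Fin.Properties using (_≟_; all?; ¬∀⟶∃¬)
open import Data.List.Base using (List; []; _∷_; length; filter; foldr; inits; map; take; takeWhile)
open import Data.List.Properties using (length-take)
open import Data.Nat.Base as ℕ using (ℕ; zero; suc; NonZero; z≤n; s≤s)
import Data.Nat.Properties as ℕₚ
open import Data.Product.Base using (∃-syntax; _,_; proj₁; proj₂)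
open import Data.Sum.Base using (_⊎_; inj₁; inj₂)
open import Data.Vec.Functional using (Vector)
open import Function.Base using (_∘_)
open import Function.Bundles using (_⇔_; mk⇔; Equivalence)
open import Level using (_⊔_) renaming (suc to lsuc)
open import Relation.Binary.Core using (Rel)
open import Relation.Binary.PropositionalEquality as ≡ using (_≡_)
open import Relation.Binary.Structures using (IsStrictPartialOrder)
open import Relation.Nullary.Decidable using (does; yes; no)
open import Relation.Nullary.Negation using (¬_; contradiction)
open import Relation.Unary using (Pred; Decidable)

-- The scalars.  The library has no real numbers, so everything below is
-- parametrised by an ordered field.  The axioms are those of a constructive
-- ordered field, satisfied by the Dedekind and Cauchy reals; under excluded
-- middle they are exactly the axioms of a linearly ordered field.

record OrderedField c ℓ₁ ℓ₂ ℓ₃ : Set (lsuc (c ⊔ ℓ₁ ⊔ ℓ₂ ⊔ ℓ₃)) where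
  field
    heytingField : HeytingField c ℓ₁ ℓ₂

  open HeytingField heytingField public

  infix 4 _<_ _≤_

  field
    _<_                  : Rel Carrier ℓ₃
    isStrictPartialOrder : IsStrictPartialOrder _≈_ _<_
    #⇔<⊎>                : ∀ {x y} → x # y ⇔ (x < y ⊎ y < x)
    +-monoʳ-<            : ∀ z {x y} → x < y → z + x < z + y
    *-pos                : ∀ {x y} → 0# < x → 0# < y → 0# < x * y

  commutativeRing : CommutativeRing c ℓ₁
  commutativeRing = HeytingCommutativeRing.commutativeRing heytingCommutativeRing

  _≤_ : Rel Carrier ℓ₃
  x ≤ y = ¬ (y < x)

-- A word lists the bins chosen by successive objects, first object first.

module Bins {k : ℕ} where

  load : Fin k → List (Fin k) → ℕ
  load i w = length (filter (i ≟_) w)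

  NoneFull : ℕ → Pred (List (Fin k)) _
  NoneFull C w = ∀ i → load i w ℕ.< C

  noneFull? : ∀ C → Decidable (NoneFull C)
  noneFull? C w = all? (λ i → load i w ℕₚ.<? C)

  -- The prefixes of w preceding the first one with a full bin have lengths
  -- 0, 1, …, N₁ - 1, so their number is N₁.

  N₁ : ℕ → List (Fin k) → ℕ
  N₁ C w = length (takeWhile (noneFull? C) (inits w))

  private
    load-∷ : ∀ i x w → load i w ℕ.≤ load i (x ∷ w)
    load-∷ i x w with i ≟ x
    ... | yes _ = ℕₚ.n≤1+n _
    ... | no  _ = ℕₚ.≤-refl

    load-take : ∀ i l w → load i (take l w) ℕ.≤ load i w
    load-take i zero    w       = z≤n
    load-take i (suc l) []      = z≤n
    load-take i (suc l) (x ∷ w) with i ≟ x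
    ... | yes _ = s≤s (load-take i l w)
    ... | no  _ = load-take i l w

    length-takeWhile-map :
      ∀ {a b p} {A : Set a} {B : Set b} {P : Pred B p} (P? : Decidable P) (f : A → B) xs →
      length (takeWhile P? (map f xs)) ≡ length (takeWhile (P? ∘ f) xs)
    length-takeWhile-map P? f []       = ≡.refl
    length-takeWhile-map P? f (x ∷ xs) with P? (f x)
    ... | yes _ = ≡.cong suc (length-takeWhile-map P? f xs)
    ... | no  _ = ≡.refl

    prefixCount :
      ∀ {a p} {A : Set a} {P : Pred (List A) p} (P? : Decidable P) →
      (∀ l w → P w → P (take l w)) →
      ∀ l w → l ℕ.≤ length w →
      l ℕ.< length (takeWhile P? (inits w)) ⇔ P (take l w)
    prefixCount P? closed l w l≤ with P? []
    prefixCount P? closed l w l≤ | no ¬p[] =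
      mk⇔ (λ ()) (λ p → contradiction (closed 0 _ p) ¬p[])
    prefixCount P? closed zero w l≤ | yes p[] = mk⇔ (λ _ → p[]) (λ _ → s≤s z≤n)
    prefixCount P? closed (suc l) (x ∷ w) (s≤s l≤) | yes p[]
      rewrite length-takeWhile-map P? (x ∷_) (inits w) =
        mk⇔ (λ { (s≤s q) → Equivalence.to rec q }) (λ p → s≤s (Equivalence.from rec p))
      where
      rec = prefixCount (P? ∘ (x ∷_)) (λ m v → closed (suc m) (x ∷ v)) l w l≤

  <N₁⇔noneFull : ∀ C l w → l ℕ.≤ length w → l ℕ.< N₁ C w ⇔ NoneFull C (take l w)
  <N₁⇔noneFull C = prefixCount (noneFull? C)
    (λ l w nf i → ℕₚ.≤-<-trans (load-take i l w) (nf i))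

  private
    module Σℕ = SemiringSum ℕₚ.+-*-semiring

    load-sum : ∀ w → Σℕ.sum (λ i → load i w) ≡ length w
    load-sum []      = Σℕ.sum-replicate-zero k
    load-sum (x ∷ w) = ≡.trans (step x) (≡.cong suc (load-sum w))
      where
      bump : ∀ {n} → Fin n → Fin n → ℕ
      bump i j = if does (i ≟ j) then 1 else 0

      bump-sum : ∀ {n} (j : Fin n) → Σℕ.sum (λ i → bump i j) ≡ 1
      bump-sum {suc n} zero    = ≡.cong suc (Σℕ.sum-replicate-zero n)
      bump-sum {suc n} (suc j) = bump-sum j

      load-bump : ∀ x i → load i (x ∷ w) ≡ bump i x ℕ.+ load i w
      load-bump x i with i ≟ x
      ... | yes _ = ≡.refl
      ... | no  _ = ≡.refl

      step : ∀ x → Σℕ.sum (λ i → load i (x ∷ w)) ≡ suc (Σℕ.sum (λ i → load i w))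
      step x = ≡.trans (Σℕ.sum-cong-≗ (load-bump x))
        (≡.trans (Σℕ.∑-distrib-+ (λ i → bump i x) (λ i → load i w))
                 (≡.cong (ℕ._+ _) (bump-sum x)))

    sum-bound : ∀ {n} C (f : Fin n → ℕ) → .{{_ : NonZero n}} →
                (∀ i → f i ℕ.< C) → Σℕ.sum f ℕ.< n ℕ.* C
    sum-bound {suc zero}    C f f<C = ℕₚ.+-mono-<-≤ (f<C zero) z≤n
    sum-bound {suc (suc n)} C f f<C =
      ℕₚ.+-mono-< (f<C zero) (sum-bound C (f ∘ suc) (f<C ∘ suc))

  -- Hence N₁ is determined by the first k * C objects.

  ¬noneFull : ∀ C w → .{{_ : NonZero k}} → length w ≡ k ℕ.* C → ¬ NoneFull C w
  ¬noneFull C w len nf =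
    ℕₚ.<-irrefl (≡.trans (load-sum w) len) (sum-bound C (λ i → load i w) nf)

  N₁≤k*C : ∀ C w → .{{_ : NonZero k}} → length w ≡ k ℕ.* C → N₁ C w ℕ.≤ k ℕ.* C
  N₁≤k*C C w len = ℕₚ.≮⇒≥ λ k*C<N₁ →
    ¬noneFull C (take (k ℕ.* C) w)
      (≡.trans (length-take (k ℕ.* C) w)
        (≡.trans (≡.cong (k ℕ.* C ℕ.⊓_) len) (ℕₚ.⊓-idem _)))
      (Equivalence.to (<N₁⇔noneFull C (k ℕ.* C) w (ℕₚ.≤-reflexive (≡.sym len))) k*C<N₁)

module StatelessAddressing {c ℓ₁ ℓ₂ ℓ₃} (F : OrderedField c ℓ₁ ℓ₂ ℓ₃) where

  open OrderedField F
  open CommutativeRing commutativeRing using (semiring; ring; setoid)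
  open SemiringMult semiring using (_×_; ×-assoc-*; ×-congʳ)
  open SemiringSum semiring using (sum; sum-replicate)
  open Bins

  record ProbVector (k : ℕ) : Set (c ⊔ ℓ₁ ⊔ ℓ₃) where
    field
      prob   : Vector Carrier k
      nonNeg : ∀ i → 0# ≤ prob i
      total  : sum prob ≈ 1#

  open ProbVector public

  sumWords : ∀ {k} (l : ℕ) → (List (Fin k) → Carrier) → Carrier
  sumWords zero    f = f []
  sumWords (suc l) f = sum (λ i → sumWords l (λ w → f (i ∷ w)))

  weight : ∀ {k} → ProbVector k → List (Fin k) → Carrier
  weight p = foldr (λ i x → prob p i * x) 1#

  -- Expectation under l independent assignments.  Continuing with the same
  -- probabilities once a bin is full affects neither the event that no bin is
  -- full nor N₁.

  𝔼 : ∀ {k} → ProbVector k → ℕ → (List (Fin k) → Carrier) → Carrier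
  𝔼 p l X = sumWords l (λ w → weight p w * X w)

  ℙ : ∀ {k a} {A : Pred (List (Fin k)) a} → ProbVector k → ℕ → Decidable A → Carrier
  ℙ p l A? = 𝔼 p l (λ w → if does (A? w) then 1# else 0#)

  ℙ[noneFull] : ∀ {k} → ℕ → ℕ → ProbVector k → Carrier
  ℙ[noneFull] C l p = ℙ p l (noneFull? C)

  -- By N₁≤k*C, a horizon of k * C objects loses nothing.

  𝔼[N₁] : ∀ {k} → ℕ → ProbVector k → Carrier
  𝔼[N₁] {k} C p = 𝔼 p (k ℕ.* C) (λ w → N₁ C w × 1#)

  _Maximizes_ : ∀ {k} → ProbVector k → (ProbVector k → Carrier) → Set (c ⊔ ℓ₁ ⊔ ℓ₃)
  p* Maximizes f = ∀ p → f p ≤ f p*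

  private
    module < = IsStrictPartialOrder isStrictPartialOrder
    open RingProperties ring using (-‿distribˡ-*; -‿involutive; -0#≈0#)
    open HeytingProperties heytingCommutativeRing using (1#0; x-0≈x)

    -‿pos : ∀ {x} → x < 0# → 0# < - x
    -‿pos {x} x<0 = <.<-respˡ-≈ (-‿inverseˡ x) (<.<-respʳ-≈ (+-identityʳ (- x)) (+-monoʳ-< (- x) x<0))

    -- -1 is not positive, since its square would be
    1≮0 : ¬ (1# < 0#)
    1≮0 1<0 = <.asym 1<0 (<.<-respʳ-≈ -1*-1≈1 (*-pos (-‿pos 1<0) (-‿pos 1<0)))
      where
      -1*-1≈1 : - 1# * - 1# ≈ 1#
      -1*-1≈1 = trans (sym (-‿distribˡ-* 1# (- 1#)))
                  (trans (-‿cong (*-identityˡ (- 1#))) (-‿involutive 1#))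

    0<1 : 0# < 1#
    0<1 with Equivalence.to #⇔<⊎> 1#0
    ... | inj₁ 1<0 = contradiction 1<0 1≮0
    ... | inj₂ 0<1 = 0<1

    0<k×1 : (k : ℕ) → .{{_ : NonZero k}} → 0# < k × 1#
    0<k×1 (suc zero)    = <.<-respʳ-≈ (sym (+-identityʳ 1#)) 0<1
    0<k×1 (suc (suc k)) =
      <.trans 0<1 (<.<-respˡ-≈ (+-identityʳ 1#) (+-monoʳ-< 1# (0<k×1 (suc k))))

    inverse : (k : ℕ) → .{{_ : NonZero k}} → ∃[ x ] (k × 1#) * x ≈ 1#
    inverse k with #⇒invertible (Equivalence.from #⇔<⊎> (inj₂ (0<k×1 k)))
    ... | x , _ , eq = x , trans (*-congʳ (sym (x-0≈x (k × 1#)))) eq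

  1/ : (k : ℕ) → .{{_ : NonZero k}} → Carrier
  1/ k = proj₁ (inverse k)

  k×1/k≈1 : (k : ℕ) → .{{_ : NonZero k}} → k × 1/ k ≈ 1#
  k×1/k≈1 k = trans (×-congʳ k (sym (*-identityˡ (1/ k))))
                (trans (sym (×-assoc-* k 1# (1/ k))) (proj₂ (inverse k)))

  1/-nonNeg : (k : ℕ) → .{{_ : NonZero k}} → 0# ≤ 1/ k
  1/-nonNeg k x<0 = <.asym 0<1 (<.<-respˡ-≈ (proj₂ (inverse k)) k1*x<0)
    where
    x = 1/ k
    m = k × 1#

    k1*x<0 : m * x < 0#
    k1*x<0 = <.<-respˡ-≈ (+-identityʳ (m * x))
      (<.<-respʳ-≈ cancel (+-monoʳ-< (m * x) (*-pos (0<k×1 k) (-‿pos x<0))))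
      where
      cancel : m * x + m * - x ≈ 0#
      cancel = trans (sym (distribˡ m x (- x)))
                 (trans (*-congˡ (-‿inverseʳ x)) (zeroʳ m))

  -- The assignment distribution of random jump consistent hashing.

  uniform : (k : ℕ) → .{{_ : NonZero k}} → ProbVector k
  uniform k = record
    { prob   = λ _ → 1/ k
    ; nonNeg = λ _ → 1/-nonNeg k
    ; total  = trans (sum-replicate k) (k×1/k≈1 k)
    }

{-# OPTIONS --safe #-}
module Submission where

-- Replace weights x, x + t + d of two bins i, j by the flatter pair x + t,
-- x + d.  Both distributions are a common part, symmetric in i and j, plus
-- letters t and d which either both go to j, or to i and j respectively.  Call
-- a function of words Schur if it does not decrease when the loads of i and j
-- are brought closer together with the same sum.  Averaging over the symmetric
-- part preserves this class, so by induction on the number of objects the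
-- flatter weights give every Schur function, in particular the indicator of
-- "no bin is full", an expectation at least as large.  A non-constant vector
-- with mean u has an entry below u and one above u; flattening the two so that
-- one becomes u reaches the constant vector u after finitely many steps.
-- Finally E[N₁] is the sum over l of the probabilities that no bin is full
-- after l objects.

open import Defs
open import Algebra.Bundles using (CommutativeRing)
import Algebra.Properties.CommutativeSemigroup as CommutativeSemigroupProperties
import Algebra.Properties.Ring as RingProperties
import Algebra.Properties.Semiring.Mult as SemiringMult
import Algebra.Properties.Semiring.Sum as SemiringSum
open import Data.Bool.Base using (if_then_else_)
open import Data.Fin.Base using (Fin; zero; suc; punchIn; toℕ)
open import Data.Fin.Permutation using (transpose; _⟨$⟩ʳ_) renaming (id to idₚ)
open import Data.Fin.Properties using (_≟_; toℕ<n)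
open import Data.List.Base using (List; []; _∷_; _++_; length; take; allFin)
open import Data.List.Membership.Propositional using (_∉_)
open import Data.List.Membership.Propositional.Properties using (∈-allFin)
open import Data.List.Properties using (filter-accept; filter-reject; ++-identityʳ)
open import Data.List.Relation.Binary.Permutation.Propositional.Properties
  using (shift; filter-↭; ↭-length)
open import Data.List.Relation.Unary.Any using (here; there)
open import Data.Nat.Base as ℕ using (ℕ; zero; suc; z≤n; s≤s; NonZero)
import Data.Nat.Properties as ℕₚ
open import Data.Product.Base using (_×_; _,_; ∃-syntax; proj₁)
open import Data.Sum.Base as Sum using (_⊎_; inj₁; inj₂; [_,_]′)
open import Data.Vec.Functional using (Vector; removeAt; updateAt)
open import Data.Vec.Functional.Properties using (updateAt-updates; updateAt-minimal)
open import Function.Base using (_∘_; const)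
open import Function.Bundles using (Equivalence)
open import Level using (_⊔_)
open import Relation.Binary.Bundles using (Poset)
import Relation.Binary.Reasoning.PartialOrder as PosetReasoning
import Relation.Binary.Reasoning.Setoid as SetoidReasoning
open import Relation.Binary.PropositionalEquality as ≡ using (_≡_; _≢_)
open import Relation.Binary.Structures using (IsStrictPartialOrder)
open import Relation.Nullary.Decidable using (Dec; does; yes; no)
open import Relation.Nullary.Negation using (¬_; contradiction)

-- Loads of words and the flattening relation.

module Flattening {k : ℕ} where

  open Bins {k}

  load-∷-≡ : ∀ i w → load i (i ∷ w) ≡ suc (load i w)
  load-∷-≡ i w = ≡.cong length (filter-accept (i ≟_) ≡.refl)

  load-∷-≢ : ∀ {i l} → i ≢ l → ∀ w → load i (l ∷ w) ≡ load i w
  load-∷-≢ {i} i≢l w = ≡.cong length (filter-reject (i ≟_) i≢l)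

  load-shift : ∀ i l v w → load i (v ++ l ∷ w) ≡ load i (l ∷ v ++ w)
  load-shift i l v w = ↭-length (filter-↭ (i ≟_) (shift l v w))

  -- With the sum fixed, the two lower bounds confine both loads of `v` to the interval from
  -- `load i w` to `load j w`. Neither bin is singled out as the lighter one in `v`, so `v` may
  -- carry the loads of `w` exchanged.
  record Flatter (i j : Fin k) (v w : List (Fin k)) : Set where
    field
      others : ∀ l → l ≢ i → l ≢ j → load l v ≡ load l w
      total  : load i v ℕ.+ load j v ≡ load i w ℕ.+ load j w
      lowᵢ   : load i w ℕ.≤ load i v
      lowⱼ   : load i w ℕ.≤ load j v

    highⱼ : load j v ℕ.≤ load j w
    highⱼ = ℕₚ.+-cancelˡ-≤ (load i w) _ _
      (ℕₚ.≤-trans (ℕₚ.+-monoˡ-≤ (load j v) lowᵢ) (ℕₚ.≤-reflexive total))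

    highᵢ : load i v ℕ.≤ load j w
    highᵢ = ℕₚ.+-cancelʳ-≤ (load i w) _ _
      (ℕₚ.≤-trans (ℕₚ.+-monoʳ-≤ (load i v) lowⱼ)
        (ℕₚ.≤-reflexive (≡.trans total (ℕₚ.+-comm (load i w) (load j w)))))

  open Flatter

  -- Flatter i j forces bin i to be the less loaded of the two in w; this is
  -- the comparison without that orientation.
  _⊑[_,_]_ : List (Fin k) → Fin k → Fin k → List (Fin k) → Set
  v ⊑[ i , j ] w = Flatter i j v w ⊎ Flatter j i v w

  sameLoads⇒⊑ : ∀ i j {v w} → (∀ l → load l v ≡ load l w) → v ⊑[ i , j ] w
  sameLoads⇒⊑ i j {v} {w} eq with ℕₚ.≤-total (load i w) (load j w)
  ... | inj₁ i≤j = inj₁ record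
    { others = λ l _ _ → eq l
    ; total  = ≡.cong₂ ℕ._+_ (eq i) (eq j)
    ; lowᵢ   = ℕₚ.≤-reflexive (≡.sym (eq i))
    ; lowⱼ   = ℕₚ.≤-trans i≤j (ℕₚ.≤-reflexive (≡.sym (eq j)))
    }
  ... | inj₂ j≤i = inj₂ record
    { others = λ l _ _ → eq l
    ; total  = ≡.cong₂ ℕ._+_ (eq j) (eq i)
    ; lowᵢ   = ℕₚ.≤-reflexive (≡.sym (eq j))
    ; lowⱼ   = ℕₚ.≤-trans j≤i (ℕₚ.≤-reflexive (≡.sym (eq i)))
    }

  -- Both loads in `v` are at most the larger of the two loads in `w`, so the bound on that one bin
  -- of `w` covers `i` and `j`.
  NoneFull-⊑ : ∀ {C i j v w} → v ⊑[ i , j ] w → NoneFull C w → NoneFull C v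
  NoneFull-⊑ {C} {v = v} (inj₁ f) = flat f
    where
    flat : ∀ {i j w} → Flatter i j v w → NoneFull C w → NoneFull C v
    flat {i} {j} f nf l with l ≟ i | l ≟ j
    ... | yes ≡.refl | _          = ℕₚ.≤-<-trans (highᵢ f) (nf j)
    ... | no _       | yes ≡.refl = ℕₚ.≤-<-trans (highⱼ f) (nf j)
    ... | no l≢i     | no l≢j     = ≡.subst (ℕ._< C) (≡.sym (others f l l≢i l≢j)) (nf l)
  NoneFull-⊑ (inj₂ f) = NoneFull-⊑ (inj₁ f)

  -- Adding one letter to each of two related words.

  module _ {i j : Fin k} (i≢j : i ≢ j) {v w} (f : Flatter i j v w) where

    private
      j≢i : j ≢ i
      j≢i = i≢j ∘ ≡.sym

    ∷-other : ∀ {l} → l ≢ i → l ≢ j → Flatter i j (l ∷ v) (l ∷ w)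
    ∷-other {l} l≢i l≢j
      with iv ← load-∷-≢ (l≢i ∘ ≡.sym) v | jv ← load-∷-≢ (l≢j ∘ ≡.sym) v
         | iw ← load-∷-≢ (l≢i ∘ ≡.sym) w | jw ← load-∷-≢ (l≢j ∘ ≡.sym) w
      = record
      { others = same
      ; total  = ≡.trans (≡.cong₂ ℕ._+_ iv jv) (≡.trans (total f) (≡.sym (≡.cong₂ ℕ._+_ iw jw)))
      ; lowᵢ   = ≡.subst₂ ℕ._≤_ (≡.sym iw) (≡.sym iv) (lowᵢ f)
      ; lowⱼ   = ≡.subst₂ ℕ._≤_ (≡.sym iw) (≡.sym jv) (lowⱼ f)
      }
      where
      same : ∀ m → m ≢ i → m ≢ j → load m (l ∷ v) ≡ load m (l ∷ w)
      same m m≢i m≢j with m ≟ l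
      ... | yes _ = ≡.cong suc (others f m m≢i m≢j)
      ... | no  _ = others f m m≢i m≢j

    private
      fromLoads : ∀ {x y a b c d} → x ≡ i ⊎ x ≡ j → y ≡ i ⊎ y ≡ j →
                  load i (x ∷ v) ≡ a → load j (x ∷ v) ≡ b →
                  load i (y ∷ w) ≡ c → load j (y ∷ w) ≡ d →
                  a ℕ.+ b ≡ c ℕ.+ d → c ℕ.≤ a → c ℕ.≤ b → Flatter i j (x ∷ v) (y ∷ w)
      fromLoads x∈ y∈ ≡a ≡b ≡c ≡d a+b≡c+d c≤a c≤b = record
        { others = λ l l≢i l≢j → ≡.trans (load-∷-≢ (apart l≢i l≢j x∈) v)
            (≡.trans (others f l l≢i l≢j) (≡.sym (load-∷-≢ (apart l≢i l≢j y∈) w)))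
        ; total  = ≡.trans (≡.cong₂ ℕ._+_ ≡a ≡b)
            (≡.trans a+b≡c+d (≡.sym (≡.cong₂ ℕ._+_ ≡c ≡d)))
        ; lowᵢ   = ≡.subst₂ ℕ._≤_ (≡.sym ≡c) (≡.sym ≡a) c≤a
        ; lowⱼ   = ≡.subst₂ ℕ._≤_ (≡.sym ≡c) (≡.sym ≡b) c≤b
        }
        where
        apart : ∀ {l x} → l ≢ i → l ≢ j → x ≡ i ⊎ x ≡ j → l ≢ x
        apart l≢i l≢j = [ (λ { ≡.refl → l≢i }) , (λ { ≡.refl → l≢j }) ]′

    -- The letter `i` raises the lower bound `load i w` by one but leaves `load j v` alone, so
    -- strict slack is required.
    ∷-low : load i w ℕ.< load j v → Flatter i j (i ∷ v) (i ∷ w)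
    ∷-low wᵢ<vⱼ = fromLoads (inj₁ ≡.refl) (inj₁ ≡.refl)
      (load-∷-≡ i v) (load-∷-≢ j≢i v) (load-∷-≡ i w) (load-∷-≢ j≢i w)
      (≡.cong suc (total f)) (s≤s (lowᵢ f)) wᵢ<vⱼ

    ∷-high : Flatter i j (j ∷ v) (j ∷ w)
    ∷-high = fromLoads (inj₂ ≡.refl) (inj₂ ≡.refl)
      (load-∷-≢ i≢j v) (load-∷-≡ j v) (load-∷-≢ i≢j w) (load-∷-≡ j w)
      (≡.trans (ℕₚ.+-suc _ _) (≡.trans (≡.cong suc (total f)) (≡.sym (ℕₚ.+-suc _ _))))
      (lowᵢ f) (ℕₚ.m≤n⇒m≤1+n (lowⱼ f))

    ∷-low-high : Flatter i j (i ∷ v) (j ∷ w)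
    ∷-low-high = fromLoads (inj₁ ≡.refl) (inj₂ ≡.refl)
      (load-∷-≡ i v) (load-∷-≢ j≢i v) (load-∷-≢ i≢j w) (load-∷-≡ j w)
      (≡.trans (≡.cong suc (total f)) (≡.sym (ℕₚ.+-suc _ _)))
      (ℕₚ.m≤n⇒m≤1+n (lowᵢ f)) (lowⱼ f)

    -- The equation makes the loads in `v` those of `w` exchanged, and exchanged letters keep them
    -- so. The strict inequality keeps bin `i` of `w` no heavier than bin `j` once it gains a
    -- letter.
    ∷-high-low : load i w ℕ.< load j w → load i w ≡ load j v → Flatter i j (j ∷ v) (i ∷ w)
    ∷-high-low wᵢ<wⱼ wᵢ≡vⱼ = fromLoads (inj₂ ≡.refl) (inj₁ ≡.refl)
      (load-∷-≢ i≢j v) (load-∷-≡ j v) (load-∷-≡ i w) (load-∷-≢ j≢i w)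
      (≡.trans (ℕₚ.+-suc _ _) (≡.cong suc (total f)))
      (ℕₚ.≤-trans wᵢ<wⱼ (ℕₚ.≤-reflexive (≡.sym vᵢ≡wⱼ))) (s≤s (lowⱼ f))
      where
      vᵢ≡wⱼ : load i v ≡ load j w
      vᵢ≡wⱼ = ℕₚ.+-cancelʳ-≡ (load i w) _ _
        (≡.trans (≡.cong (load i v ℕ.+_) wᵢ≡vⱼ)
          (≡.trans (total f) (ℕₚ.+-comm (load i w) (load j w))))

  -- `Flatter i j v w` already gives `load i w ≤ load j w`, so the hypothesis amounts to equal loads
  -- in `w`, where the orientation is arbitrary.
  Flatter-flip : ∀ {i j v w} → load j w ℕ.≤ load i w → Flatter i j v w → Flatter j i v w
  Flatter-flip {i} {j} {v} {w} wⱼ≤wᵢ f = record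
    { others = λ l l≢j l≢i → others f l l≢i l≢j
    ; total  = ≡.trans (ℕₚ.+-comm (load j v) (load i v))
        (≡.trans (total f) (ℕₚ.+-comm (load i w) (load j w)))
    ; lowᵢ   = ℕₚ.≤-trans wⱼ≤wᵢ (lowⱼ f)
    ; lowⱼ   = ℕₚ.≤-trans wⱼ≤wᵢ (lowᵢ f)
    }

  module _ {i j : Fin k} (i≢j : i ≢ j) {v w} (f : Flatter i j v w) where

    ∷-mirror : load i w ≡ load j v → (j ∷ v) ⊑[ i , j ] (i ∷ w)
    ∷-mirror wᵢ≡vⱼ with load i w ℕₚ.<? load j w
    ... | yes wᵢ<wⱼ = inj₁ (∷-high-low i≢j f wᵢ<wⱼ wᵢ≡vⱼ)
    -- All four loads agree here, and the new letter makes `i` the heavier bin of `w`, so the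
    -- orientation turns around.
    ... | no  wᵢ≮wⱼ = inj₂ (∷-low-high (i≢j ∘ ≡.sym) (Flatter-flip (ℕₚ.≮⇒≥ wᵢ≮wⱼ) f))

    -- Letters can be added to v and w in step, except that when the loads
    -- of i and j in v are those of w exchanged, their roles are exchanged too.
    coupling : ∃[ π ] (∀ l → ((π ⟨$⟩ʳ l) ∷ v) ⊑[ i , j ] (l ∷ w)) ×
                      (∀ l → π ⟨$⟩ʳ l ≡ l ⊎ (π ⟨$⟩ʳ l ≡ i × l ≡ j) ⊎ (π ⟨$⟩ʳ l ≡ j × l ≡ i))
    coupling with ℕₚ.m≤n⇒m<n∨m≡n (lowⱼ f)
    ... | inj₁ wᵢ<vⱼ = idₚ , sync , λ l → inj₁ ≡.refl
      where
      sync : ∀ l → (l ∷ v) ⊑[ i , j ] (l ∷ w)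
      sync l with l ≟ i | l ≟ j
      ... | yes ≡.refl | _          = inj₁ (∷-low i≢j f wᵢ<vⱼ)
      ... | no _       | yes ≡.refl = inj₁ (∷-high i≢j f)
      ... | no l≢i     | no l≢j     = inj₁ (∷-other i≢j f l≢i l≢j)
    ... | inj₂ wᵢ≡vⱼ = transpose i j , mirror , moved
      where
      mirror : ∀ l → ((transpose i j ⟨$⟩ʳ l) ∷ v) ⊑[ i , j ] (l ∷ w)
      mirror l with l ≟ i
      ... | yes ≡.refl = ∷-mirror wᵢ≡vⱼ
      ... | no l≢i with l ≟ j
      ...   | yes ≡.refl = inj₁ (∷-low-high i≢j f)
      ...   | no l≢j     = inj₁ (∷-other i≢j f l≢i l≢j)
      moved : ∀ l → transpose i j ⟨$⟩ʳ l ≡ l ⊎ (transpose i j ⟨$⟩ʳ l ≡ i × l ≡ j) ⊎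
                    (transpose i j ⟨$⟩ʳ l ≡ j × l ≡ i)
      moved l with l ≟ i
      ... | yes l≡i = inj₂ (inj₂ (≡.refl , l≡i))
      ... | no _ with l ≟ j
      ...   | yes l≡j = inj₂ (inj₁ (≡.refl , l≡j))
      ...   | no _    = inj₁ ≡.refl

-- Inequalities and finite sums in an ordered field.

module OrderedFieldProperties {c ℓ₁ ℓ₂ ℓ₃} (F : OrderedField c ℓ₁ ℓ₂ ℓ₃) where

  open OrderedField F hiding (zero)
  open CommutativeRing commutativeRing using (ring; semiring)
  open SemiringSum semiring
  open RingProperties ring using (//-rightDividesˡ)
  private module < = IsStrictPartialOrder isStrictPartialOrder

  <⇒≤ : ∀ {x y} → x < y → x ≤ y
  <⇒≤ = <.asym

  ≤-antisym : ∀ {x y} → x ≤ y → y ≤ x → x ≈ y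
  ≤-antisym {x} {y} x≤y y≤x = proj₁ (tight x y) λ x#y →
    [ y≤x , x≤y ]′ (Equivalence.to #⇔<⊎> x#y)

  ≤-reflexive : ∀ {x y} → x ≈ y → x ≤ y
  ≤-reflexive x≈y y<x = <.irrefl (sym x≈y) y<x

  -- Given `z < x`, an inequality `x < y` would yield `z < y`; hence `x ≈ y`, and `z < x` itself
  -- contradicts `y ≤ z`.
  ≤-trans : ∀ {x y z} → x ≤ y → y ≤ z → x ≤ z
  ≤-trans {x} {y} {z} x≤y y≤z z<x = y≤z (<.<-respʳ-≈ x≈y z<x)
    where
    x≈y : x ≈ y
    x≈y = ≤-antisym x≤y (λ x<y → y≤z (<.trans z<x x<y))

  ≤-poset : Poset c ℓ₁ ℓ₃
  ≤-poset = record
    { isPartialOrder = record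
      { isPreorder = record
        { isEquivalence = isEquivalence ; reflexive = ≤-reflexive ; trans = ≤-trans }
      ; antisym = ≤-antisym
      }
    }

  +-cancelˡ-< : ∀ z {x y} → z + x < z + y → x < y
  +-cancelˡ-< z {x} {y} lt = <.<-respˡ-≈ (cancel x) (<.<-respʳ-≈ (cancel y) (+-monoʳ-< (- z) lt))
    where
    cancel : ∀ x → - z + (z + x) ≈ x
    cancel x = trans (sym (+-assoc (- z) z x)) (trans (+-congʳ (-‿inverseˡ z)) (+-identityˡ x))

  +-monoʳ-≤ : ∀ z {x y} → x ≤ y → z + x ≤ z + y
  +-monoʳ-≤ z x≤y = x≤y ∘ +-cancelˡ-< z

  +-cancelˡ-≤ : ∀ z {x y} → z + x ≤ z + y → x ≤ y
  +-cancelˡ-≤ z le = le ∘ +-monoʳ-< z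

  open PosetReasoning ≤-poset

  +-mono-≤ : ∀ {x y u v} → x ≤ y → u ≤ v → x + u ≤ y + v
  +-mono-≤ {x} {y} {u} {v} x≤y u≤v = begin
    x + u  ≤⟨ +-monoʳ-≤ x u≤v ⟩
    x + v  ≈⟨ +-comm x v ⟩
    v + x  ≤⟨ +-monoʳ-≤ v x≤y ⟩
    v + y  ≈⟨ +-comm v y ⟩
    y + v  ∎

  +-nonNeg : ∀ {x y} → 0# ≤ x → 0# ≤ y → 0# ≤ x + y
  +-nonNeg 0≤x 0≤y = ≤-trans (≤-reflexive (sym (+-identityˡ 0#))) (+-mono-≤ 0≤x 0≤y)

  x+[y-x]≈y : ∀ x y → x + (y - x) ≈ y
  x+[y-x]≈y x y = trans (+-comm x (y - x)) (//-rightDividesˡ x y)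

  x<y⇒0<y-x : ∀ {x y} → x < y → 0# < y - x
  x<y⇒0<y-x {x} {y} x<y = +-cancelˡ-< x
    (<.<-respˡ-≈ (sym (+-identityʳ x)) (<.<-respʳ-≈ (sym (x+[y-x]≈y x y)) x<y))

  *-monoˡ-< : ∀ {z x y} → 0# < z → x < y → z * x < z * y
  *-monoˡ-< {z} {x} {y} 0<z x<y =
    <.<-respˡ-≈ (+-identityʳ (z * x)) (<.<-respʳ-≈ eq
      (+-monoʳ-< (z * x) (*-pos 0<z (x<y⇒0<y-x x<y))))
    where
    eq : z * x + z * (y - x) ≈ z * y
    eq = trans (sym (distribˡ z x (y - x))) (*-congˡ (x+[y-x]≈y x y))

  -- The sign of `z` is not decided. Instead, the assumption `z * y < z * x` refutes `0# < z`, which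
  -- leaves `z ≈ 0#`, and then both products vanish.
  *-monoˡ-≤ : ∀ {z x y} → 0# ≤ z → x ≤ y → z * x ≤ z * y
  *-monoˡ-≤ {z} {x} {y} 0≤z x≤y zy<zx = <.irrefl zy≈zx zy<zx
    where
    z≤0 : z ≤ 0#
    z≤0 0<z = <.irrefl (*-congˡ (sym x≈y)) zy<zx
      where
      x≈y : x ≈ y
      x≈y = ≤-antisym x≤y (λ x<y → <.asym zy<zx (*-monoˡ-< 0<z x<y))
    z≈0 : z ≈ 0#
    z≈0 = ≤-antisym z≤0 0≤z
    zy≈zx : z * y ≈ z * x
    zy≈zx = trans (trans (*-congʳ z≈0) (zeroˡ y)) (sym (trans (*-congʳ z≈0) (zeroˡ x)))

  sum-mono-≤ : ∀ {n} {f g : Vector Carrier n} → (∀ i → f i ≤ g i) → sum f ≤ sum g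
  sum-mono-≤ {zero}  f≤g = ≤-reflexive refl
  sum-mono-≤ {suc n} f≤g = +-mono-≤ (f≤g zero) (sum-mono-≤ (f≤g ∘ suc))

  -- An excess of `g` at one index cannot be compensated elsewhere: compare the sums without that
  -- index and cancel.
  sum-≤-tight : ∀ {n} {f g : Vector Carrier n} → (∀ i → f i ≤ g i) →
                sum g ≤ sum f → ∀ i → g i ≤ f i
  sum-≤-tight {suc n} {f} {g} f≤g Σg≤Σf i = +-cancelˡ-≤ (sum (removeAt g i)) (begin
    sum (removeAt g i) + g i  ≈⟨ +-comm _ _ ⟩
    g i + sum (removeAt g i)  ≈⟨ sum-remove g ⟨
    sum g                     ≤⟨ Σg≤Σf ⟩
    sum f                     ≈⟨ sum-remove f ⟩
    f i + sum (removeAt f i)  ≈⟨ +-comm _ _ ⟩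
    sum (removeAt f i) + f i  ≤⟨ +-mono-≤ (sum-mono-≤ (λ j → f≤g (punchIn i j))) (≤-reflexive refl) ⟩
    sum (removeAt g i) + f i  ∎)

module Maximality {c ℓ₁ ℓ₂ ℓ₃} (F : OrderedField c ℓ₁ ℓ₂ ℓ₃) where

  open OrderedField F hiding (zero)
  open CommutativeRing commutativeRing using (semiring; +-commutativeSemigroup)
  open SemiringMult semiring using () renaming (_×_ to _×#_)
  open SemiringSum semiring
  open CommutativeSemigroupProperties +-commutativeSemigroup using (xy∙z≈xz∙y)
  open OrderedFieldProperties F
  private module < = IsStrictPartialOrder isStrictPartialOrder
  module ≤-R = PosetReasoning ≤-poset
  module ≈-R = SetoidReasoning setoid

  -- Weighted sums and weight vectors with one entry raised.

  infixl 7 _·_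
  _·_ : ∀ {n} → Vector Carrier n → Vector Carrier n → Carrier
  q · f = sum (λ i → q i * f i)

  infixl 8 _[_+=_]
  _[_+=_] : ∀ {n} → Vector Carrier n → Fin n → Carrier → Vector Carrier n
  q [ i += t ] = updateAt q i (_+ t)

  sum-+= : ∀ {n} (q : Vector Carrier n) i t → sum (q [ i += t ]) ≈ sum q + t
  sum-+= {suc n} q zero    t = trans (+-assoc _ _ _) (trans (+-congˡ (+-comm _ _)) (sym (+-assoc _ _ _)))
  sum-+= {suc n} q (suc i) t = trans (+-congˡ (sum-+= (q ∘ suc) i t)) (sym (+-assoc _ _ _))

  ·-+= : ∀ {n} (q : Vector Carrier n) i t f → q [ i += t ] · f ≈ q · f + t * f i
  ·-+= {suc n} q zero    t f = trans (+-congʳ (distribʳ _ _ _)) (xy∙z≈xz∙y _ _ _)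
  ·-+= {suc n} q (suc i) t f =
    trans (+-congˡ (·-+= (q ∘ suc) i t (f ∘ suc))) (sym (+-assoc _ _ _))

  +=-nonNeg : ∀ {n} {q : Vector Carrier n} i {t} → (∀ l → 0# ≤ q l) → 0# ≤ t →
              ∀ l → 0# ≤ (q [ i += t ]) l
  +=-nonNeg zero    q≥0 t≥0 zero    = +-nonNeg (q≥0 zero) t≥0
  +=-nonNeg zero    q≥0 t≥0 (suc l) = q≥0 (suc l)
  +=-nonNeg (suc i) q≥0 t≥0 zero    = q≥0 zero
  +=-nonNeg (suc i) q≥0 t≥0 (suc l) = +=-nonNeg i (q≥0 ∘ suc) t≥0 l

  -- Expectations over words of fixed length.

  module _ {k : ℕ} where

    open Bins {k}
    open Flattening {k}

    -- 𝔼, for weights that need not sum to 1.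
    E : Vector Carrier k → ℕ → (List (Fin k) → Carrier) → Carrier
    E q zero    X = X []
    E q (suc n) X = q · (λ i → E q n (X ∘ (i ∷_)))

    E-cong : ∀ q n {X Y} → (∀ w → length w ≡ n → X w ≈ Y w) → E q n X ≈ E q n Y
    E-cong q zero    eq = eq [] ≡.refl
    E-cong q (suc n) eq =
      sum-cong-≋ (λ i → *-congˡ (E-cong q n (λ w len → eq (i ∷ w) (≡.cong suc len))))

    E-congˡ : ∀ {q q′} → (∀ i → q i ≈ q′ i) → ∀ n X → E q n X ≈ E q′ n X
    E-congˡ eq zero    X = refl
    E-congˡ eq (suc n) X = sum-cong-≋ (λ i → *-cong (eq i) (E-congˡ eq n (X ∘ (i ∷_))))

    E-* : ∀ q n a X → E q n (λ w → a * X w) ≈ a * E q n X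
    E-* q zero    a X = refl
    E-* q (suc n) a X = begin
      q · (λ i → E q n (λ w → a * X (i ∷ w)))
        ≈⟨ sum-cong-≋ (λ i →
             trans (*-congˡ (E-* q n a (X ∘ (i ∷_)))) (x*yz≈y*xz (q i) a _)) ⟩
      sum (λ i → a * (q i * E q n (X ∘ (i ∷_))))
        ≈⟨ *-distribˡ-sum a (λ i → q i * E q n (X ∘ (i ∷_))) ⟨
      a * E q (suc n) X
        ∎
      where
      open ≈-R
      open CommutativeSemigroupProperties (CommutativeRing.*-commutativeSemigroup commutativeRing)
        using () renaming (x∙yz≈y∙xz to x*yz≈y*xz)

    E-sum : ∀ q n {m} (X : Fin m → List (Fin k) → Carrier) →
            E q n (λ w → sum (λ t → X t w)) ≈ sum (λ t → E q n (X t))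
    E-sum q zero    X = refl
    E-sum q (suc n) X = begin
      q · (λ i → E q n (λ w → sum (λ t → X t (i ∷ w))))
        ≈⟨ sum-cong-≋ (λ i → trans (*-congˡ (E-sum q n (λ t → X t ∘ (i ∷_))))
               (*-distribˡ-sum (q i) (λ t → E q n (X t ∘ (i ∷_))))) ⟩
      sum (λ i → sum (λ t → q i * E q n (X t ∘ (i ∷_))))
        ≈⟨ ∑-comm (λ i t → q i * E q n (X t ∘ (i ∷_))) ⟩
      sum (λ t → E q (suc n) (X t))
        ∎
      where open ≈-R

    -- Each letter after the first `l` contributes a factor `sum q`, which is 1.
    E-take : ∀ {q} → sum q ≈ 1# → ∀ {l n} X → l ℕ.≤ n → E q n (X ∘ take l) ≈ E q l X
    E-take {q} Σq≈1 {n = zero}  X z≤n = refl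
    E-take {q} Σq≈1 {n = suc n} X z≤n = begin
      q · (λ _ → E q n (λ _ → X []))  ≈⟨ sum-cong-≋ (λ i → *-congˡ {q i} (E-take Σq≈1 {n = n} X z≤n)) ⟩
      q · (λ _ → X [])                ≈⟨ *-distribʳ-sum (X []) q ⟨
      sum q * X []                    ≈⟨ *-congʳ Σq≈1 ⟩
      1# * X []                       ≈⟨ *-identityˡ (X []) ⟩
      X []                            ∎
      where open ≈-R
    E-take {q} Σq≈1 X (s≤s l≤n) = sum-cong-≋ (λ i → *-congˡ (E-take Σq≈1 (X ∘ (i ∷_)) l≤n))

    -- Schur-concavity in the loads of two bins.

    Schur : Fin k → Fin k → (List (Fin k) → Carrier) → Set _
    Schur i j g = ∀ {v w} → v ⊑[ i , j ] w → g w ≤ g v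

    -- Words with equal loads are related in both directions, so `g` sees only loads. This lets the
    -- letter drawn first be moved behind those still to come.
    Schur-exchange : ∀ {i j g} → Schur i j g → ∀ l v w → g (l ∷ v ++ w) ≈ g (v ++ l ∷ w)
    Schur-exchange {i} {j} schur l v w = ≤-antisym
      (schur (sameLoads⇒⊑ i j (λ m → load-shift m l v w)))
      (schur (sameLoads⇒⊑ i j (λ m → ≡.sym (load-shift m l v w))))

    average : Vector Carrier k → (List (Fin k) → Carrier) → List (Fin k) → Carrier
    average a g w = a · (λ l → g (l ∷ w))

    -- The coupling pairs the letter `l` before `w` with `π l` before `v`. Since `π` moves at most
    -- `i` and `j`, whose weights agree, reindexing by `π` turns the result into the average at `v`.
    Schur-average : ∀ {i j a g} → i ≢ j → (∀ l → 0# ≤ a l) → a i ≈ a j →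
                    Schur i j g → Schur i j (average a g)
    Schur-average {i} {j} {a} {g} i≢j a≥0 aᵢ≈aⱼ schur =
      [ oriented i≢j aᵢ≈aⱼ schur
      , oriented (i≢j ∘ ≡.sym) (sym aᵢ≈aⱼ) (schur ∘ Sum.swap) ]′
      where
      oriented : ∀ {i j v w} → i ≢ j → a i ≈ a j → Schur i j g → Flatter i j v w →
                 average a g w ≤ average a g v
      oriented {i} {j} {v} {w} i≢j aᵢ≈aⱼ schur f with coupling i≢j f
      ... | π , coupled , moved = begin
        sum (λ l → a l * g (l ∷ w))
          ≤⟨ sum-mono-≤ (λ l → *-monoˡ-≤ (a≥0 l) (schur (coupled l))) ⟩
        sum (λ l → a l * g ((π ⟨$⟩ʳ l) ∷ v))
          ≈⟨ sum-cong-≋ (λ l → *-congʳ (a∘π l)) ⟨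
        sum (λ l → a (π ⟨$⟩ʳ l) * g ((π ⟨$⟩ʳ l) ∷ v))
          ≈⟨ sum-permute (λ l → a l * g (l ∷ v)) π ⟨
        sum (λ l → a l * g (l ∷ v))
          ∎
        where
        open ≤-R
        a∘π : ∀ l → a (π ⟨$⟩ʳ l) ≈ a l
        a∘π l with moved l
        ... | inj₁ πl≡l                   = reflexive (≡.cong a πl≡l)
        ... | inj₂ (inj₁ (πl≡i , ≡.refl)) = trans (reflexive (≡.cong a πl≡i)) aᵢ≈aⱼ
        ... | inj₂ (inj₂ (πl≡j , ≡.refl)) = trans (reflexive (≡.cong a πl≡j)) (sym aᵢ≈aⱼ)

    module _ {i j : Fin k} (i≢j : i ≢ j) {a : Vector Carrier k}
             (a≥0 : ∀ l → 0# ≤ a l) (aᵢ≈aⱼ : a i ≈ a j) where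

      E-average : ∀ q n {g} → Schur i j g → ∀ w →
                  a · (λ l → E q n (λ u → g (l ∷ u ++ w))) ≈ E q n (λ u → average a g (u ++ w))
      E-average q n {g} schur w = begin
        a · (λ l → E q n (λ u → g (l ∷ u ++ w)))
          ≈⟨ sum-cong-≋ (λ l → E-* q n (a l) _) ⟨
        sum (λ l → E q n (λ u → a l * g (l ∷ u ++ w)))
          ≈⟨ E-sum q n (λ l u → a l * g (l ∷ u ++ w)) ⟨
        E q n (λ u → average a g (u ++ w))
          ∎
        where open ≈-R

      -- A letter drawn from the common part `a` is averaged into `g`; one drawn from the extra mass
      -- `t` or `d` is moved into the suffixes. For the induction on `n` the statement therefore
      -- ranges over all Schur `g` and all flatter pairs of suffixes.
      E-+=-mono : ∀ {t d} → 0# ≤ t → 0# ≤ d → ∀ n {g} → Schur i j g →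
        ∀ {v w} → Flatter i j v w →
        E (a [ j += t + d ]) n (λ u → g (u ++ w)) ≤
        E (a [ i += t ] [ j += d ]) n (λ u → g (u ++ v))
      E-+=-mono t≥0 d≥0 zero schur f = schur (inj₁ f)
      E-+=-mono {t} {d} t≥0 d≥0 (suc n) {g} schur {v} {w} f = begin
        q · Q w
          ≈⟨ ·-+= a j (t + d) (Q w) ⟩
        a · Q w + (t + d) * Q w j
          ≈⟨ +-cong (E-average q n schur w) (*-congˡ (Q-∷ w j)) ⟩
        E q n (λ u → average a g (u ++ w)) + (t + d) * E q n (λ u → g (u ++ j ∷ w))
          ≈⟨ trans (+-congˡ (distribʳ _ t d)) (sym (+-assoc _ _ _)) ⟩
        E q n (λ u → average a g (u ++ w)) + t * E q n (λ u → g (u ++ j ∷ w))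
          + d * E q n (λ u → g (u ++ j ∷ w))
          -- The mass `t` adds `j` to `w` but `i` to `v`, while `d` adds `j` to both; either way `v`
          -- stays flatter than `w`.
          ≤⟨ +-mono-≤ (+-mono-≤
               (E-+=-mono t≥0 d≥0 n (Schur-average i≢j a≥0 aᵢ≈aⱼ schur) f)
               (*-monoˡ-≤ t≥0 (E-+=-mono t≥0 d≥0 n schur (∷-low-high i≢j f))))
               (*-monoˡ-≤ d≥0 (E-+=-mono t≥0 d≥0 n schur (∷-high i≢j f))) ⟩
        E q′ n (λ u → average a g (u ++ v)) + t * E q′ n (λ u → g (u ++ i ∷ v))
          + d * E q′ n (λ u → g (u ++ j ∷ v))
          ≈⟨ +-cong (+-cong (E-average q′ n schur v) (*-congˡ (Q′-∷ v i))) (*-congˡ (Q′-∷ v j)) ⟨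
        a · Q′ v + t * Q′ v i + d * Q′ v j
          ≈⟨ +-congʳ (·-+= a i t (Q′ v)) ⟨
        a [ i += t ] · Q′ v + d * Q′ v j
          ≈⟨ ·-+= (a [ i += t ]) j d (Q′ v) ⟨
        q′ · Q′ v
          ∎
        where
        open ≤-R
        q  = a [ j += t + d ]
        q′ = a [ i += t ] [ j += d ]
        Q Q′ : List (Fin k) → Vector Carrier k
        Q  w l = E q  n (λ u → g (l ∷ u ++ w))
        Q′ v l = E q′ n (λ u → g (l ∷ u ++ v))
        Q-∷ : ∀ w l → Q w l ≈ E q n (λ u → g (u ++ l ∷ w))
        Q-∷ w l = E-cong q n (λ u _ → Schur-exchange schur l u w)
        Q′-∷ : ∀ v l → Q′ v l ≈ E q′ n (λ u → g (u ++ l ∷ v))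
        Q′-∷ v l = E-cong q′ n (λ u _ → Schur-exchange schur l u v)

    -- Flattening two entries of a weight vector.

    record Flattens (i j : Fin k) (t d : Carrier) (q q′ : Vector Carrier k) :
                    Set (c ⊔ ℓ₁ ⊔ ℓ₃) where
      field
        nonNeg : ∀ l → 0# ≤ q′ l
        mass   : sum q′ ≈ sum q
        atᵢ    : q′ i ≈ q i + t
        atⱼ    : q′ j ≈ q i + d
        rest   : ∀ l → l ≢ i → l ≢ j → q′ l ≈ q l
        E-mono : ∀ n {g} → Schur i j g → E q n g ≤ E q′ n g

    flatten : ∀ {i j q t d} → i ≢ j → (∀ l → 0# ≤ q l) → 0# ≤ t → 0# ≤ d →
              q j ≈ q i + (t + d) → ∃[ q′ ] Flattens i j t d q q′
    flatten {i} {j} {q} {t} {d} i≢j q≥0 t≥0 d≥0 qⱼ≈ = q′ , record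
      { nonNeg = +=-nonNeg j (+=-nonNeg i a≥0 t≥0) d≥0
      ; mass   = mass
      ; atᵢ    = trans (reflexive (updateAt-minimal i j (a [ i += t ]) i≢j))
                   (trans (reflexive (updateAt-updates i a)) (+-congʳ aᵢ≈qᵢ))
      ; atⱼ    = trans (reflexive (updateAt-updates j (a [ i += t ])))
                   (+-congʳ (trans (reflexive (updateAt-minimal j i a j≢i)) aⱼ≈qᵢ))
      ; rest   = λ l l≢i l≢j → trans (reflexive (updateAt-minimal l j (a [ i += t ]) l≢j))
                   (trans (reflexive (updateAt-minimal l i a l≢i)) (reflexive (updateAt-minimal l j q l≢j)))
      ; E-mono = E-mono
      }
      where
      j≢i = i≢j ∘ ≡.sym
      -- The part common to old and new weights: entry `j` is lowered to `q i`, which makes it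
      -- symmetric in `i` and `j`. Adding `t + d` at `j` restores `q`.
      a  = updateAt q j (const (q i))
      q′ = a [ i += t ] [ j += d ]

      aᵢ≈qᵢ : a i ≈ q i
      aᵢ≈qᵢ = reflexive (updateAt-minimal i j q i≢j)

      aⱼ≈qᵢ : a j ≈ q i
      aⱼ≈qᵢ = reflexive (updateAt-updates j q)

      a≥0 : ∀ l → 0# ≤ a l
      a≥0 l with l ≟ j
      ... | yes ≡.refl = ≤-trans (q≥0 i) (≤-reflexive (sym aⱼ≈qᵢ))
      ... | no l≢j     =
        ≤-trans (q≥0 l) (≤-reflexive (sym (reflexive (updateAt-minimal l j q l≢j))))

      q≈ : ∀ l → q l ≈ (a [ j += t + d ]) l
      q≈ l with l ≟ j
      ... | yes ≡.refl = trans qⱼ≈ (trans (+-congʳ (sym aⱼ≈qᵢ))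
                           (sym (reflexive (updateAt-updates j a))))
      ... | no l≢j     = sym (trans (reflexive (updateAt-minimal l j a l≢j))
                           (reflexive (updateAt-minimal l j q l≢j)))

      mass : sum q′ ≈ sum q
      mass = begin
        sum q′                    ≈⟨ sum-+= (a [ i += t ]) j d ⟩
        sum (a [ i += t ]) + d    ≈⟨ +-congʳ (sum-+= a i t) ⟩
        sum a + t + d             ≈⟨ +-assoc (sum a) t d ⟩
        sum a + (t + d)           ≈⟨ sum-+= a j (t + d) ⟨
        sum (a [ j += t + d ])    ≈⟨ sum-cong-≋ q≈ ⟨
        sum q                     ∎
        where open ≈-R

      E-mono : ∀ n {g} → Schur i j g → E q n g ≤ E q′ n g
      E-mono n {g} schur = begin
        E q n g                                  ≈⟨ E-congˡ q≈ n g ⟩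
        E (a [ j += t + d ]) n g                 ≈⟨ ++[] (a [ j += t + d ]) ⟨
        E (a [ j += t + d ]) n (λ u → g (u ++ []))
          -- The comparison starts from empty suffixes, all of whose loads are zero.
          ≤⟨ E-+=-mono i≢j a≥0 (trans aᵢ≈qᵢ (sym aⱼ≈qᵢ)) t≥0 d≥0 n schur
               (record { others = λ _ _ _ → ≡.refl ; total = ≡.refl ; lowᵢ = z≤n ; lowⱼ = z≤n }) ⟩
        E q′ n (λ u → g (u ++ []))               ≈⟨ ++[] q′ ⟩
        E q′ n g                                 ∎
        where
        open ≤-R
        ++[] : ∀ q → E q n (λ u → g (u ++ [])) ≈ E q n g
        ++[] q = E-cong q n (λ u _ → reflexive (≡.cong g (++-identityʳ u)))

    -- Reaching the constant vector.

    open Flattens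

    E-≤-constant : ∀ {g} → (∀ i j → i ≢ j → Schur i j g) → ∀ n {q u} → (∀ l → 0# ≤ q l) →
                   sum q ≈ sum (const {B = Fin k} u) → E q n g ≤ E (const u) n g
    E-≤-constant {g} schur n {q} {u} q≥0 Σq≈ =
      -- The list holds the bins whose entry is not yet known to equal `u`. Initially it holds every
      -- bin, so the last argument is vacuous.
      settle (allFin k) q q≥0 Σq≈ (λ l l∉ → contradiction (∈-allFin l) l∉)
      where
      module _ {q : Vector Carrier k} (q≥0 : ∀ l → 0# ≤ q l)
               {i j : Fin k} (qᵢ<u : q i < u) (u<qⱼ : u < q j) where

        low≢high : i ≢ j
        low≢high ≡.refl = <.asym qᵢ<u u<qⱼ

        t = u - q i
        d = q j - u

        t≥0 : 0# ≤ t
        t≥0 = <⇒≤ (x<y⇒0<y-x qᵢ<u)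

        d≥0 : 0# ≤ d
        d≥0 = <⇒≤ (x<y⇒0<y-x u<qⱼ)

        qⱼ≈ : q j ≈ q i + (t + d)
        qⱼ≈ = begin
          q j            ≈⟨ x+[y-x]≈y u (q j) ⟨
          u + d          ≈⟨ +-congʳ (x+[y-x]≈y (q i) u) ⟨
          q i + t + d    ≈⟨ +-assoc (q i) t d ⟩
          q i + (t + d)  ∎
          where open ≈-R

        -- The gap `q j - q i` is cut at `u` into `t` and `d`; the order in which the two pieces are
        -- handed out decides which of the two bins lands on `u`.
        flatten-at : ∀ {m} → m ≡ i ⊎ m ≡ j →
                     ∃[ t ] ∃[ d ] ∃[ q′ ] Flattens i j t d q q′ × q′ m ≈ u
        flatten-at (inj₁ ≡.refl) with flatten low≢high q≥0 t≥0 d≥0 qⱼ≈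
        ... | q′ , f = t , d , q′ , f , trans (atᵢ f) (x+[y-x]≈y (q i) u)
        flatten-at (inj₂ ≡.refl)
          with flatten low≢high q≥0 d≥0 t≥0 (trans qⱼ≈ (+-congˡ (+-comm t d)))
        ... | q′ , f = d , t , q′ , f , trans (atⱼ f) (x+[y-x]≈y (q i) u)

      -- The order is not decidable.  But _≤_ is a negation, so Eu<Eq may be assumed;
      -- then no entry can be flattened against m, which forces q m ≈ u.
      settle : ∀ ms q → (∀ l → 0# ≤ q l) → sum q ≈ sum (const {B = Fin k} u) →
               (∀ l → l ∉ ms → q l ≈ u) → E q n g ≤ E (const u) n g
      settle []       q q≥0 Σq≈ settled = ≤-reflexive (E-congˡ (λ l → settled l (λ ())) n g)
      settle (m ∷ ms) q q≥0 Σq≈ settled Eu<Eq = settle ms q q≥0 Σq≈ all-settled Eu<Eq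
        where
        settled-∉ : ∀ l → l ∉ ms → l ≢ m → q l ≈ u
        settled-∉ l l∉ms l≢m = settled l λ { (here l≡m) → l≢m l≡m ; (there l∈ms) → l∉ms l∈ms }

        -- Flattening would bring entry `m` to `u` without lowering the expectation, and the
        -- recursion on the shorter list `ms` would then refute `Eu<Eq`.
        unflattenable : ∀ {i j} → m ≡ i ⊎ m ≡ j → q i < u → ¬ (u < q j)
        unflattenable {i} {j} m∈ qᵢ<u u<qⱼ with flatten-at q≥0 qᵢ<u u<qⱼ m∈
        ... | _ , _ , q′ , f , q′ₘ≈u = ≤-trans (E-mono f n (schur i j (low≢high q≥0 qᵢ<u u<qⱼ)))
                         (settle ms q′ (nonNeg f) (trans (mass f) Σq≈) settled′) Eu<Eq
          where
          settled′ : ∀ l → l ∉ ms → q′ l ≈ u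
          settled′ l l∉ms with l ≟ m | l ≟ i | l ≟ j
          ... | yes ≡.refl | _          | _          = q′ₘ≈u
          -- Settled entries equal `u`, whereas `q i` and `q j` lie strictly off it; so no settled
          -- bin other than `m` takes part in the flattening.
          ... | no l≢m     | yes ≡.refl | _          =
            contradiction qᵢ<u (<.irrefl (settled-∉ l l∉ms l≢m))
          ... | no l≢m     | no _       | yes ≡.refl =
            contradiction u<qⱼ (<.irrefl (sym (settled-∉ l l∉ms l≢m)))
          ... | no l≢m     | no l≢i     | no l≢j     =
            trans (rest f l l≢i l≢j) (settled-∉ l l∉ms l≢m)

        -- If `u < q m`, no entry lies below `u`, and equality of the sums forces `q m ≤ u`. The
        -- case `q m < u` is symmetric.
        qₘ≈u : q m ≈ u
        qₘ≈u = ≤-antisym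
          (λ u<qₘ → sum-≤-tight {f = const u} {g = q}
            (λ l qₗ<u → unflattenable (inj₂ ≡.refl) qₗ<u u<qₘ) (≤-reflexive Σq≈) m u<qₘ)
          (λ qₘ<u → sum-≤-tight {f = q} {g = const u}
            (λ l u<qₗ → unflattenable (inj₁ ≡.refl) qₘ<u u<qₗ) (≤-reflexive (sym Σq≈)) m qₘ<u)

        all-settled : ∀ l → l ∉ ms → q l ≈ u
        all-settled l l∉ms with l ≟ m
        ... | yes ≡.refl = qₘ≈u
        ... | no l≢m     = settled-∉ l l∉ms l≢m

  -- Probabilities that no bin is full, and the expectation of `N₁`.

  open StatelessAddressing F

  module _ {k : ℕ} where

    open Bins {k}
    open Flattening {k}

    sumWords-cong : ∀ l {f g : List (Fin k) → Carrier} →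
                    (∀ w → f w ≈ g w) → sumWords l f ≈ sumWords l g
    sumWords-cong zero    f≈g = f≈g []
    sumWords-cong (suc l) f≈g = sum-cong-≋ (λ i → sumWords-cong l (f≈g ∘ (i ∷_)))

    sumWords-* : ∀ l a (f : List (Fin k) → Carrier) →
                 sumWords l (λ w → a * f w) ≈ a * sumWords l f
    sumWords-* zero    a f = refl
    sumWords-* (suc l) a f = trans (sum-cong-≋ (λ i → sumWords-* l a (f ∘ (i ∷_))))
      (sym (*-distribˡ-sum a (λ i → sumWords l (f ∘ (i ∷_)))))

    -- The weight of a word is a product over its letters, so the factor of the first letter can be
    -- pulled out of the inner sum at each stage.
    𝔼≈E : (p : ProbVector k) → ∀ l X → 𝔼 p l X ≈ E (prob p) l X
    𝔼≈E p zero    X = *-identityˡ (X [])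
    𝔼≈E p (suc l) X = sum-cong-≋ (λ i → begin
      sumWords l (λ w → prob p i * weight p w * X (i ∷ w))
        ≈⟨ sumWords-cong l (λ w → *-assoc (prob p i) (weight p w) (X (i ∷ w))) ⟩
      sumWords l (λ w → prob p i * (weight p w * X (i ∷ w)))
        ≈⟨ sumWords-* l (prob p i) (λ w → weight p w * X (i ∷ w)) ⟩
      prob p i * 𝔼 p l (X ∘ (i ∷_))
        ≈⟨ *-congˡ (𝔼≈E p l (X ∘ (i ∷_))) ⟩
      prob p i * E (prob p) l (X ∘ (i ∷_))
        ∎)
      where open ≈-R

    0≤1 : 0# ≤ 1#
    0≤1 = ≤-trans (1/-nonNeg 1) (≤-reflexive (trans (sym (+-identityʳ (1/ 1))) (k×1/k≈1 1)))

    𝟙 : ∀ {a} {A : Set a} → Dec A → Carrier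
    𝟙 A? = if does A? then 1# else 0#

    𝟙-mono : ∀ {a b} {A : Set a} {B : Set b} (A? : Dec A) (B? : Dec B) → (A → B) → 𝟙 A? ≤ 𝟙 B?
    𝟙-mono (yes a) (yes _) A⇒B = ≤-reflexive refl
    𝟙-mono (yes a) (no ¬b) A⇒B = contradiction (A⇒B a) ¬b
    𝟙-mono (no _)  (yes _) A⇒B = 0≤1
    𝟙-mono (no _)  (no _)  A⇒B = ≤-reflexive refl

    𝟙-yes : ∀ {a} {A : Set a} (A? : Dec A) → A → 𝟙 A? ≈ 1#
    𝟙-yes (yes _) a = refl
    𝟙-yes (no ¬a) a = contradiction a ¬a

    𝟙-no : ∀ {a} {A : Set a} (A? : Dec A) → ¬ A → 𝟙 A? ≈ 0#
    𝟙-no (yes a) ¬a = contradiction a ¬a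
    𝟙-no (no _)  ¬a = refl

    𝟙-noneFull : ℕ → List (Fin k) → Carrier
    𝟙-noneFull C w = 𝟙 (noneFull? C w)

    Schur-𝟙 : ∀ {i j} C → Schur i j (𝟙-noneFull C)
    Schur-𝟙 C {v} {w} v⊑w = 𝟙-mono (noneFull? C w) (noneFull? C v) (NoneFull-⊑ v⊑w)

    E-noneFull-≤-uniform : .{{_ : NonZero k}} → ∀ C l (p : ProbVector k) →
      E (prob p) l (𝟙-noneFull C) ≤ E (prob (uniform k)) l (𝟙-noneFull C)
    E-noneFull-≤-uniform C l p = E-≤-constant (λ _ _ _ → Schur-𝟙 C) l (ProbVector.nonNeg p)
      (trans (total p) (sym (total (uniform k))))

    ×#-indicator : ∀ m {n} (f : Vector Carrier n) → m ℕ.≤ n →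
                   (∀ t → toℕ t ℕ.< m → f t ≈ 1#) → (∀ t → ¬ (toℕ t ℕ.< m) → f t ≈ 0#) →
                   sum f ≈ m ×# 1#
    ×#-indicator zero {n} f m≤n one nil =
      trans (sum-cong-≋ (λ t → nil t (λ ()))) (sum-replicate-zero n)
    ×#-indicator (suc m) f (s≤s m≤n) one nil = +-cong (one zero (s≤s z≤n))
      (×#-indicator m (f ∘ suc) m≤n (λ t → one (suc t) ∘ s≤s)
        (λ t t≮m → nil (suc t) (t≮m ∘ ℕₚ.≤-pred)))

    -- The tail-sum formula: `N₁` counts the `t` below it, and these are the `t` for which no bin is
    -- full after `t` objects. The range of `t` is long enough because `N₁` is at most `k * C`.
    N₁-sum : .{{_ : NonZero k}} → ∀ C w → length w ≡ k ℕ.* C →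
             N₁ C w ×# 1# ≈ ∑[ t < k ℕ.* C ] 𝟙-noneFull C (take (toℕ t) w)
    N₁-sum C w len = sym (×#-indicator (N₁ C w) _ (N₁≤k*C C w len)
      (λ t t<N₁ → 𝟙-yes (noneFull? C (take (toℕ t) w)) (Equivalence.to (iff t) t<N₁))
      (λ t t≮N₁ → 𝟙-no (noneFull? C (take (toℕ t) w)) (t≮N₁ ∘ Equivalence.from (iff t))))
      where
      iff = λ (t : Fin (k ℕ.* C)) → <N₁⇔noneFull C (toℕ t) w
        (ℕₚ.≤-trans (ℕₚ.<⇒≤ (toℕ<n t)) (ℕₚ.≤-reflexive (≡.sym len)))

    𝔼[N₁]≈ : .{{_ : NonZero k}} → ∀ C (p : ProbVector k) →
             𝔼[N₁] C p ≈ ∑[ t < k ℕ.* C ] E (prob p) (toℕ t) (𝟙-noneFull C)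
    𝔼[N₁]≈ C p = begin
      𝔼[N₁] C p
        ≈⟨ 𝔼≈E p (k ℕ.* C) _ ⟩
      E (prob p) (k ℕ.* C) (λ w → N₁ C w ×# 1#)
        ≈⟨ E-cong (prob p) (k ℕ.* C) (N₁-sum C) ⟩
      E (prob p) (k ℕ.* C) (λ w → ∑[ t < k ℕ.* C ] 𝟙-noneFull C (take (toℕ t) w))
        ≈⟨ E-sum (prob p) (k ℕ.* C) {k ℕ.* C} (λ t → 𝟙-noneFull C ∘ take (toℕ t)) ⟩
      ∑[ t < k ℕ.* C ] E (prob p) (k ℕ.* C) (𝟙-noneFull C ∘ take (toℕ t))
        -- The `t`-th indicator depends on the first `t` letters only, so the later ones integrate
        -- out.
        ≈⟨ sum-cong-≋ {k ℕ.* C} (λ t → E-take (total p) (𝟙-noneFull C) (ℕₚ.<⇒≤ (toℕ<n t))) ⟩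
      ∑[ t < k ℕ.* C ] E (prob p) (toℕ t) (𝟙-noneFull C)
        ∎
      where open ≈-R

theorem4 : ∀ {c ℓ₁ ℓ₂ ℓ₃} (F : OrderedField c ℓ₁ ℓ₂ ℓ₃) (k C : ℕ) .{{_ : NonZero k}} .{{_ : NonZero C}} →
    let open StatelessAddressing F in
    (∀ l → uniform k Maximizes ℙ[noneFull] C l) × (uniform k Maximizes 𝔼[N₁] C)
theorem4 F k C =
  (λ l p → begin
    ℙ[noneFull] C l p                           ≈⟨ 𝔼≈E p l (𝟙-noneFull C) ⟩
    E (prob p) l (𝟙-noneFull C)                 ≤⟨ E-noneFull-≤-uniform C l p ⟩
    E (prob (uniform k)) l (𝟙-noneFull C)       ≈⟨ 𝔼≈E (uniform k) l (𝟙-noneFull C) ⟨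
    ℙ[noneFull] C l (uniform k)                 ∎) ,
  (λ p → begin
    𝔼[N₁] C p                                   ≈⟨ 𝔼[N₁]≈ C p ⟩
    ∑[ t < k ℕ.* C ] E (prob p) (toℕ t) (𝟙-noneFull C)
      -- The range of summation does not depend on `p`, so the bound for each fixed number of
      -- objects applies term by term.
      ≤⟨ sum-mono-≤ {k ℕ.* C} (λ t → E-noneFull-≤-uniform C (toℕ t) p) ⟩
    ∑[ t < k ℕ.* C ] E (prob (uniform k)) (toℕ t) (𝟙-noneFull C)
                                                ≈⟨ 𝔼[N₁]≈ C (uniform k) ⟨
    𝔼[N₁] C (uniform k)                         ∎)
  where
  open OrderedField F using (commutativeRing)
  open SemiringSum (CommutativeRing.semiring commutativeRing) using (sum-syntax)
  open OrderedFieldProperties F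
  open StatelessAddressing F
  open Maximality F
  open PosetReasoning ≤-poset
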